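{- Let $\boldsymbol{\Upsilon}_{\mathbf{G}}:\mathbf{G}\to\mathbf{WSym}$ be the linear map sending a graph $G$ with vertex set $[n]$ to its chromatic symmetric function in non-commuting variables, $\boldsymbol{\Upsilon}_{\mathbf{G}}(G)=\sum_f \mathbf{a}_{f(1)}\cdots\mathbf{a}_{f(n)}$, the sum running over proper colorings $f$ of $G$. Then the linear subspace $\ker\boldsymbol{\Upsilon}_{\mathbf{G}}$ of $\mathbf{G}$ is spanned by the modular relations on graphs, and the image of $\boldsymbol{\Upsilon}_{\mathbf{G}}$ is $\mathbf{WSym}$.
   Context: $\mathbb{K}$ is a field of characteristic zero; $\mathbb{N}=\{1,2,\dots\}$ and $[n]=\{1,\dots,n\}$. $\mathbf{G}=\bigoplus_{n\ge 0}\mathbf{G}_n$, where $\mathbf{G}_n$ is the $\mathbb{K}$-vector space freely generated by the (simple) graphs with vertex set $[n]$. A coloring of $G$ is a function $f:V(G)\to\mathbb{N}$; it is proper if no edge is monochromatic. $\{\mathbf{a}_i\}_{i\ge 1}$ are non-commuting variables. For a set partition $\boldsymbol{\pi}$ of $[n]$ let $\mathbf{m}_{\boldsymbol{\pi}}=\sum_f \mathbf{a}_{f(1)}\cdots\mathbf{a}_{f(n)}$, the sum running over all $f:[n]\to\mathbb{N}$ such that $f(i)=f(j)$ if and only if $i,j$ lie in the same block of $\boldsymbol{\pi}$. $\mathbf{WSym}=\bigoplus_{n\ge 0}\mathbf{WSym}_n$, where $\mathbf{WSym}_n$ is the $\mathbb{K}$-span of $\{\mathbf{m}_{\boldsymbol{\pi}}\}$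 over set partitions $\boldsymbol{\pi}$ of $[n]$. Modular relation on graphs: let $G$ be a graph with vertex set $[n]$ and $e_1,e_2,e_3$ the three edges of a triangle on three distinct vertices of $[n]$ with $e_3\in E(G)$ and $e_1,e_2\notin E(G)$. The corresponding modular relation is the element $G-G\cup\{e_1\}-G\cup\{e_2\}+G\cup\{e_1,e_2\}$ of $\mathbf{G}$, where $G\cup E$ denotes $G$ with the edges in $E$ added. -}

module Defs where

open import Algebra.Apartness.Bundles using (HeytingField; HeytingCommutativeRing)
open import Algebra.Bundles using (CommutativeRing)
import Algebra.Definitions.RawMonoid as RawMonoidDefinitions
open import Algebra.Module.Bundles using (Module)
open import Algebra.Module.Morphism.Structures using (module ModuleMorphisms)
open import Algebra.Module.Structures using (IsLeftModule)
open import Algebra.Module.Structures.Biased using (IsModuleFromLeft)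
open import Data.Bool.Base using (Bool; true; false; T; _∧_; _∨_; if_then_else_)
open import Data.Bool.Properties using (T?; ∧-comm; ∨-comm)
open import Data.Fin.Base using (Fin)
import Data.Fin.Properties as Fin
open import Data.Fin.Subset using (Subset; _∈_; _∩_; Nonempty; Empty)
open import Data.Fin.Subset.Properties using (_∈?_)
open import Data.List.Base using (List; []; _∷_; foldr; length; lookup)
open import Data.List.Relation.Unary.All using (All)
open import Data.List.Relation.Unary.AllPairs using (AllPairs)
open import Data.List.Relation.Unary.Any using (Any; any?)
open import Data.Nat.Base using (ℕ; suc)
import Data.Nat.Properties as ℕ
open import Data.Product.Base using (Σ; ∃; _×_; _,_; proj₁; proj₂)
open import Function.Bundles using (_⇔_; mk⇔; Equivalence)
open import Level using (Level; 0ℓ; _⊔_)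
open import Relation.Binary.Bundles using (Setoid)
open import Relation.Binary.Core using (Rel)
open import Relation.Binary.PropositionalEquality
  using (_≡_; _≢_; refl; sym; trans; cong; cong₂; subst)
open import Relation.Nullary.Decidable
  using (Dec; yes; no; does; map′; _×-dec_; _→-dec_; ¬?; does-⇔)
open import Relation.Nullary.Negation using (¬_; contradiction)
open import Relation.Unary using (Pred; Decidable)

------------------------------------------------------------------------
-- Linear algebra

module LinearAlgebra {r ℓr : Level} (R : CommutativeRing r ℓr) where

  private module R = CommutativeRing R

  module _ {m ℓm : Level} (M : Module R m ℓm) where
    open Module M

    linearCombination : {i : Level} {I : Set i} →
                        (I → Carrierᴹ) → List (R.Carrier × I) → Carrierᴹ
    linearCombination v = foldr (λ (c , i) s → c *ₗ v i +ᴹ s) 0ᴹ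

    Span : {i : Level} {I : Set i} → (I → Carrierᴹ) → Pred Carrierᴹ (r ⊔ ℓm ⊔ i)
    Span v x = ∃ λ cs → x ≈ᴹ linearCombination v cs

  module _ {m ℓm n ℓn : Level} (M : Module R m ℓm) (N : Module R n ℓn) where
    private
      module M = Module M
      module N = Module N

    Kernel : (M.Carrierᴹ → N.Carrierᴹ) → Pred M.Carrierᴹ ℓn
    Kernel φ x = φ x N.≈ᴹ N.0ᴹ

    Image : (M.Carrierᴹ → N.Carrierᴹ) → Pred N.Carrierᴹ (m ⊔ ℓn)
    Image φ y = ∃ λ x → φ x N.≈ᴹ y

  -- The free module on a setoid: formal expressions in the generators,
  -- modulo the least congruence that satisfies the module axioms and
  -- identifies equal generators.

  module Free {a ℓa : Level} (S : Setoid a ℓa) where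
    private module S = Setoid S

    infixr 8 ⊖_
    infixr 7 _⊙_
    infixl 6 _⊕_
    infix  4 _≋_

    data Expr : Set (r ⊔ a) where
      gen  : S.Carrier → Expr
      𝟎    : Expr
      _⊕_  : Expr → Expr → Expr
      ⊖_   : Expr → Expr
      _⊙_  : R.Carrier → Expr → Expr

    data _≋_ : Rel Expr (r ⊔ ℓr ⊔ a ⊔ ℓa) where
      ≋-refl      : ∀ {x} → x ≋ x
      ≋-sym       : ∀ {x y} → x ≋ y → y ≋ x
      ≋-trans     : ∀ {x y z} → x ≋ y → y ≋ z → x ≋ z
      gen-cong    : ∀ {s t} → s S.≈ t → gen s ≋ gen t
      ⊕-cong      : ∀ {x x′ y y′} → x ≋ x′ → y ≋ y′ → x ⊕ y ≋ x′ ⊕ y′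
      ⊖-cong      : ∀ {x y} → x ≋ y → ⊖ x ≋ ⊖ y
      ⊙-cong      : ∀ {c d x y} → c R.≈ d → x ≋ y → c ⊙ x ≋ d ⊙ y
      ⊕-assoc     : ∀ x y z → (x ⊕ y) ⊕ z ≋ x ⊕ (y ⊕ z)
      ⊕-comm      : ∀ x y → x ⊕ y ≋ y ⊕ x
      ⊕-identityˡ : ∀ x → 𝟎 ⊕ x ≋ x
      ⊕-inverseˡ  : ∀ x → ⊖ x ⊕ x ≋ 𝟎
      ⊙-zeroˡ     : ∀ x → R.0# ⊙ x ≋ 𝟎
      ⊙-zeroʳ     : ∀ c → c ⊙ 𝟎 ≋ 𝟎
      ⊙-distribˡ  : ∀ c x y → c ⊙ (x ⊕ y) ≋ c ⊙ x ⊕ c ⊙ y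
      ⊙-distribʳ  : ∀ x c d → (c R.+ d) ⊙ x ≋ c ⊙ x ⊕ d ⊙ x
      ⊙-identityˡ : ∀ x → R.1# ⊙ x ≋ x
      ⊙-assoc     : ∀ c d x → (c R.* d) ⊙ x ≋ c ⊙ (d ⊙ x)

    isLeftModule : IsLeftModule R.ring _≋_ _⊕_ 𝟎 ⊖_ _⊙_
    isLeftModule = record
      { isLeftSemimodule = record
        { +ᴹ-isCommutativeMonoid = record
          { isMonoid = record
            { isSemigroup = record
              { isMagma = record
                { isEquivalence = record
                  { refl = ≋-refl ; sym = ≋-sym ; trans = ≋-trans }
                ; ∙-cong = ⊕-cong
                }
              ; assoc = ⊕-assoc
              }
            ; identity = ⊕-identityˡ
                       , λ x → ≋-trans (⊕-comm x 𝟎) (⊕-identityˡ x)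
            }
          ; comm = ⊕-comm
          }
        ; isPreleftSemimodule = record
          { *ₗ-cong      = ⊙-cong
          ; *ₗ-zeroˡ     = ⊙-zeroˡ
          ; *ₗ-distribʳ  = ⊙-distribʳ
          ; *ₗ-identityˡ = ⊙-identityˡ
          ; *ₗ-assoc     = ⊙-assoc
          ; *ₗ-zeroʳ     = ⊙-zeroʳ
          ; *ₗ-distribˡ  = ⊙-distribˡ
          }
        }
      ; -ᴹ‿cong    = ⊖-cong
      ; -ᴹ‿inverse = ⊕-inverseˡ
                   , λ x → ≋-trans (⊕-comm x (⊖ x)) (⊕-inverseˡ x)
      }

    freeModule : Module R (r ⊔ a) (r ⊔ ℓr ⊔ a ⊔ ℓa)
    freeModule = record
      { isModule = IsModuleFromLeft.isModule {commutativeRing = R}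
          record { isLeftModule = isLeftModule }
      }

    module _ {m ℓm : Level} (M : Module R m ℓm) where
      private module M = Module M

      extend : (S.Carrier → M.Carrierᴹ) → Expr → M.Carrierᴹ
      extend f (gen s) = f s
      extend f 𝟎       = M.0ᴹ
      extend f (x ⊕ y) = extend f x M.+ᴹ extend f y
      extend f (⊖ x)   = M.-ᴹ extend f x
      extend f (c ⊙ x) = c M.*ₗ extend f x

      module _ (f : S.Carrier → M.Carrierᴹ)
               (f-cong : ∀ {s t} → s S.≈ t → f s M.≈ᴹ f t) where

        extend-cong : ∀ {x y} → x ≋ y → extend f x M.≈ᴹ extend f y
        extend-cong ≋-refl             = M.≈ᴹ-refl
        extend-cong (≋-sym p)          = M.≈ᴹ-sym (extend-cong p)
        extend-cong (≋-trans p q)      = M.≈ᴹ-trans (extend-cong p) (extend-cong q)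
        extend-cong (gen-cong p)       = f-cong p
        extend-cong (⊕-cong p q)       = M.+ᴹ-cong (extend-cong p) (extend-cong q)
        extend-cong (⊖-cong p)         = M.-ᴹ‿cong (extend-cong p)
        extend-cong (⊙-cong p q)       = M.*ₗ-cong p (extend-cong q)
        extend-cong (⊕-assoc x y z)    = M.+ᴹ-assoc _ _ _
        extend-cong (⊕-comm x y)       = M.+ᴹ-comm _ _
        extend-cong (⊕-identityˡ x)    = M.+ᴹ-identityˡ _
        extend-cong (⊕-inverseˡ x)     = M.-ᴹ‿inverseˡ _
        extend-cong (⊙-zeroˡ x)        = M.*ₗ-zeroˡ _
        extend-cong (⊙-zeroʳ c)        = M.*ₗ-zeroʳ _
        extend-cong (⊙-distribˡ c x y) = M.*ₗ-distribˡ _ _ _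
        extend-cong (⊙-distribʳ x c d) = M.*ₗ-distribʳ _ _ _
        extend-cong (⊙-identityˡ x)    = M.*ₗ-identityˡ _
        extend-cong (⊙-assoc c d x)    = M.*ₗ-assoc _ _ _

        open ModuleMorphisms (Module.rawModule freeModule) M.rawModule

        extend-isModuleHomomorphism : IsModuleHomomorphism (extend f)
        extend-isModuleHomomorphism = record
          { isBimoduleHomomorphism = record
            { +ᴹ-isGroupHomomorphism = record
              { isMonoidHomomorphism = record
                { isMagmaHomomorphism = record
                  { isRelHomomorphism = record { cong = extend-cong }
                  ; homo = λ _ _ → M.≈ᴹ-refl
                  }
                ; ε-homo = M.≈ᴹ-refl
                }
              ; ⁻¹-homo = λ _ → M.≈ᴹ-refl
              }
            ; *ₗ-homo = λ _ _ → M.≈ᴹ-refl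
            ; *ᵣ-homo = λ c x → M.*ₗ-*ᵣ-coincident c (extend f x)
            }
          }

------------------------------------------------------------------------
-- Graphs

record Graph (n : ℕ) : Set where
  field
    adj         : Fin n → Fin n → Bool
    symmetric   : ∀ i j → adj i j ≡ adj j i
    irreflexive : ∀ i → adj i i ≡ false

  Adjacent : Rel (Fin n) 0ℓ
  Adjacent i j = T (adj i j)

open Graph using (adj; Adjacent) public

infix 4 _≈ᴳ_

data _≈ᴳ_ : Rel (∃ Graph) 0ℓ where
  sameEdges : ∀ {n} {G H : Graph n} →
              (∀ i j → adj G i j ≡ adj H i j) → (n , G) ≈ᴳ (n , H)

graphSetoid : Setoid 0ℓ 0ℓ
graphSetoid = record
  { Carrier = ∃ Graph
  ; _≈_     = _≈ᴳ_
  ; isEquivalence = record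
    { refl  = sameEdges λ _ _ → refl
    ; sym   = λ { (sameEdges p) → sameEdges λ i j → sym (p i j) }
    ; trans = λ { (sameEdges p) (sameEdges q) →
                  sameEdges λ i j → trans (p i j) (q i j) }
    }
  }

isEdge : ∀ {n} → (i j : Fin n) → Fin n → Fin n → Bool
isEdge i j a b = (does (a Fin.≟ i) ∧ does (b Fin.≟ j))
               ∨ (does (a Fin.≟ j) ∧ does (b Fin.≟ i))

addEdge : ∀ {n} → Graph n → (i j : Fin n) → i ≢ j → Graph n
addEdge G i j i≢j = record
  { adj         = λ a b → adj G a b ∨ isEdge i j a b
  ; symmetric   = λ a b → cong₂ _∨_ (Graph.symmetric G a b)
      (trans (∨-comm (does (a Fin.≟ i) ∧ does (b Fin.≟ j)) _)
             (cong₂ _∨_ (∧-comm (does (a Fin.≟ j)) _) (∧-comm (does (a Fin.≟ i)) _)))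
  ; irreflexive = λ a → cong₂ _∨_ (Graph.irreflexive G a) (noLoop a)
  }
  where
  noLoop : ∀ a → isEdge i j a a ≡ false
  noLoop a with a Fin.≟ i | a Fin.≟ j
  ... | yes refl | yes refl = contradiction refl i≢j
  ... | yes _    | no _     = refl
  ... | no _     | yes _    = refl
  ... | no _     | no _     = refl

-- A triangle with edges e₁ = ij, e₂ = ik, e₃ = jk.  Every numbering of the
-- edges of a triangle has this form, with i the common vertex of e₁ and e₂.

record ModularTriangle : Set where
  field
    {order} : ℕ
    graph   : Graph order
    i j k   : Fin order
    i≢j     : i ≢ j
    i≢k     : i ≢ k
    j≢k     : j ≢ k
    e₁∉     : ¬ Adjacent graph i j
    e₂∉     : ¬ Adjacent graph i k
    e₃∈     : Adjacent graph j k

------------------------------------------------------------------------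
-- Colorings and set partitions

-- Only the labels of the colors matter: the color c : ℕ stands for the
-- (c+1)-st positive integer.

Coloring : ℕ → Set
Coloring n = Fin n → ℕ

Proper : ∀ {n} → Graph n → Pred (Coloring n) 0ℓ
Proper G f = ∀ i j → Adjacent G i j → f i ≢ f j

proper? : ∀ {n} (G : Graph n) → Decidable (Proper G)
proper? G f = Fin.all? λ i → Fin.all? λ j → T? (adj G i j) →-dec ¬? (f i ℕ.≟ f j)

record SetPartition (n : ℕ) : Set where
  field
    blocks   : List (Subset n)
    nonempty : All Nonempty blocks
    disjoint : AllPairs (λ B C → Empty (B ∩ C)) blocks
    covering : ∀ i → Any (i ∈_) blocks

  SameBlock : Rel (Fin n) 0ℓ
  SameBlock i j = Any (λ B → i ∈ B × j ∈ B) blocks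

  sameBlock? : ∀ i j → Dec (SameBlock i j)
  sameBlock? i j = any? (λ B → (i ∈? B) ×-dec (j ∈? B)) blocks

open SetPartition using (SameBlock; sameBlock?) public

HasKernel : ∀ {n} → SetPartition n → Pred (Coloring n) 0ℓ
HasKernel π f = ∀ i j → f i ≡ f j ⇔ SameBlock π i j

hasKernel? : ∀ {n} (π : SetPartition n) → Decidable (HasKernel π)
hasKernel? π f = Fin.all? λ i → Fin.all? λ j →
  map′ (λ (to , from) → mk⇔ to from)
       (λ eq → Equivalence.to eq , Equivalence.from eq)
       ((f i ℕ.≟ f j →-dec sameBlock? π i j) ×-dec
        (sameBlock? π i j →-dec f i ℕ.≟ f j))

------------------------------------------------------------------------
-- The chromatic symmetric function in non-commuting variables

-- Fields are Heyting fields; a field with decidable equality is one, with ≉ as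
-- its apartness.

CharacteristicZero : {c ℓ₁ ℓ₂ : Level} → HeytingField c ℓ₁ ℓ₂ → Set ℓ₁
CharacteristicZero K = ∀ n → ¬ (suc n · 1# ≈ 0#)
  where
  open HeytingField K
  open CommutativeRing (HeytingCommutativeRing.commutativeRing heytingCommutativeRing)
    using (+-rawMonoid)
  open RawMonoidDefinitions +-rawMonoid using () renaming (_×_ to _·_)

module _ {c ℓ₁ ℓ₂ : Level} (K : HeytingField c ℓ₁ ℓ₂) where

  scalars : CommutativeRing c ℓ₁
  scalars = HeytingCommutativeRing.commutativeRing
              (HeytingField.heytingCommutativeRing K)

  private module K = CommutativeRing scalars

  open LinearAlgebra scalars using (Span; module Free)

  -- Formal power series in the non-commuting variables, as the function that
  -- takes each word to its coefficient.

  Series : Set c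
  Series = List ℕ → K.Carrier

  series : Module scalars c ℓ₁
  series = record
    { Carrierᴹ = Series
    ; _≈ᴹ_     = λ s t → ∀ w → s w K.≈ t w
    ; _+ᴹ_     = λ s t w → s w K.+ t w
    ; _*ₗ_     = λ a s w → a K.* s w
    ; 0ᴹ       = λ _ → K.0#
    ; -ᴹ_      = λ s w → K.- s w
    ; isModule = IsModuleFromLeft.isModule {commutativeRing = scalars} record
      { isLeftModule = record
        { isLeftSemimodule = record
          { +ᴹ-isCommutativeMonoid = record
            { isMonoid = record
              { isSemigroup = record
                { isMagma = record
                  { isEquivalence = record
                    { refl  = λ _ → K.refl
                    ; sym   = λ p w → K.sym (p w)
                    ; trans = λ p q w → K.trans (p w) (q w)
                    }
                  ; ∙-cong = λ p q w → K.+-cong (p w) (q w)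
                  }
                ; assoc = λ s t u w → K.+-assoc (s w) (t w) (u w)
                }
              ; identity = (λ s w → K.+-identityˡ (s w))
                         , (λ s w → K.+-identityʳ (s w))
              }
            ; comm = λ s t w → K.+-comm (s w) (t w)
            }
          ; isPreleftSemimodule = record
            { *ₗ-cong      = λ p q w → K.*-cong p (q w)
            ; *ₗ-zeroˡ     = λ s w → K.zeroˡ (s w)
            ; *ₗ-distribʳ  = λ s a b w → K.distribʳ (s w) a b
            ; *ₗ-identityˡ = λ s w → K.*-identityˡ (s w)
            ; *ₗ-assoc     = λ a b s w → K.*-assoc a b (s w)
            ; *ₗ-zeroʳ     = λ a w → K.zeroʳ a
            ; *ₗ-distribˡ  = λ a s t w → K.distribˡ a (s w) (t w)
            }
          }
        ; -ᴹ‿cong    = λ p w → K.-‿cong (p w)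
        ; -ᴹ‿inverse = (λ s w → K.-‿inverseˡ (s w))
                     , (λ s w → K.-‿inverseʳ (s w))
        }
      }
    }

  -- The sum of the monomials a_f(1)⋯a_f(n) over all f satisfying P.  The word
  -- w arises from exactly one f if its length is n, namely lookup w, and from
  -- none otherwise, so its coefficient is 0 or 1.

  monomialSum : ∀ {n} {P : Pred (Coloring n) 0ℓ} → Decidable P → Series
  monomialSum {n} P? w with length w ℕ.≟ n
  ... | yes refl = if does (P? (lookup w)) then K.1# else K.0#
  ... | no  _    = K.0#

  𝐦 : ∃ SetPartition → Series
  𝐦 (_ , π) = monomialSum (hasKernel? π)

  -- The sum of the homogeneous components is direct, so it is the span of all
  -- the 𝐦 π together.

  WSym : Pred Series (c ⊔ ℓ₁)
  WSym = Span series 𝐦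

  open Free graphSetoid

  -- ⨁ₙ 𝐆ₙ is the vector space freely generated by the graphs of all orders.

  𝐆 : Module scalars c (c ⊔ ℓ₁)
  𝐆 = freeModule

  chromatic : ∃ Graph → Series
  chromatic (_ , G) = monomialSum (proper? G)

  Υ : Module.Carrierᴹ 𝐆 → Series
  Υ = extend series chromatic

  modularRelation : ModularTriangle → Module.Carrierᴹ 𝐆
  modularRelation t =
      gen (_ , graph)
    - gen (_ , addEdge graph i j i≢j)
    - gen (_ , addEdge graph i k i≢k)
    + gen (_ , addEdge (addEdge graph i j i≢j) i k i≢k)
    where
    open ModularTriangle t
    open Module 𝐆 using () renaming (_+ᴹ_ to _+_; -ᴹ_ to neg)
    infixl 6 _-_
    _-_ : Module.Carrierᴹ 𝐆 → Module.Carrierᴹ 𝐆 → Module.Carrierᴹ 𝐆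
    x - y = x + neg y

  chromatic-cong : ∀ {G H} → G ≈ᴳ H → Module._≈ᴹ_ series (chromatic G) (chromatic H)
  chromatic-cong (sameEdges {n} {G} {H} p) w with length w ℕ.≟ n
  ... | no _     = K.refl
  ... | yes refl = K.reflexive (cong (λ b → if b then K.1# else K.0#)
          (does-⇔ (mk⇔ (λ P i j e → P i j (subst T (sym (p i j)) e))
                       (λ P i j e → P i j (subst T (p i j) e)))
                  (proper? G (lookup w)) (proper? H (lookup w))))

  open ModuleMorphisms (Module.rawModule 𝐆) (Module.rawModule series)

  Υ-isModuleHomomorphism : IsModuleHomomorphism Υ
  Υ-isModuleHomomorphism = extend-isModuleHomomorphism series chromatic chromatic-cong

{-# OPTIONS --safe #-}
module Submission where

-- For a list O of pairs of vertices let μ(O, G) = Σ (-1)^|S| (G ∪ S), summed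
-- over the subsets S of O.  Splitting on each pair in turn expands G as the sum
-- of μ(O, G ∪ I) over all ways of distributing the pairs of vertices between
-- I and O, and Υ μ(O, H) is the sum over the proper colorings of H that are
-- constant on the pairs in O.  Let H be the graph with edges I.  If O contains
-- an edge of H, then μ(O, H) = 0.  Otherwise O consists of the nonadjacent pairs.
-- If nonadjacency in H is not transitive, O contains two pairs ij and ik with jk
-- an edge, and μ(O, H) is an alternating sum of modular relations.  If it is
-- transitive, its classes form a set partition π with Υ μ(O, H) = 𝐦 π, and the
-- coefficient of μ(O, H) in the expansion of G is the coefficient in Υ G of
-- the word that colors every vertex with the representative of its class.
-- Hence x is determined by Υ x modulo modular relations.

open import Defs
open import Algebra.Apartness.Bundles using (HeytingField)
open import Algebra.Bundles using (CommutativeMonoid; CommutativeRing)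
open import Algebra.Module.Bundles using (Module)
import Algebra.Module.Properties as ModuleProperties
import Algebra.Properties.AbelianGroup as AbelianGroupProperties
import Algebra.Properties.CommutativeSemigroup as CommutativeSemigroupProperties
import Algebra.Properties.Ring as RingProperties
open import Data.Bool.Base using (false; T; not; _∨_; if_then_else_)
open import Data.Bool.Properties using (T?; T-∨; T-≡; ∨-assoc; ∨-comm)
open import Data.Fin.Base using (Fin; toℕ; cast)
import Data.Fin.Properties as Fin
open import Data.Fin.Subset using (Subset; _∩_; Empty) renaming (_∈_ to _∈ˢ_)
open import Data.Fin.Subset.Properties using (x∈p∩q⁻)
open import Data.List.Base
  using (List; []; _∷_; _++_; allFin; concatMap; filter; length; lookup; map; tabulate)
open import Data.List.Membership.Propositional using (_∈_; find; lose)
open import Data.List.Membership.Propositional.Properties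
  using (∈-allFin; ∈-concatMap⁺; ∈-filter⁺; ∈-filter⁻; ∈-map⁺; ∈-map⁻; ∈-∃++)
open import Data.List.Properties using (filter-≐; length-tabulate; lookup-tabulate)
open import Data.List.Relation.Binary.Permutation.Propositional as ↭ using (_↭_; ↭-trans)
open import Data.List.Relation.Binary.Permutation.Propositional.Properties
  using (shift; ++-comm; ∈-resp-↭)
open import Data.List.Relation.Unary.All as All using (All; []; _∷_)
import Data.List.Relation.Unary.All.Properties as All
open import Data.List.Relation.Unary.AllPairs as AllPairs using (AllPairs)
import Data.List.Relation.Unary.AllPairs.Properties as AllPairs
open import Data.List.Relation.Unary.Any using (Any; here; there; any?)
open import Data.List.Relation.Unary.Unique.Propositional.Properties using (allFin⁺)
open import Data.Nat.Base using (ℕ; zero; suc; _≤_; _<_) renaming (_⊔_ to max)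
import Data.Nat.Properties as ℕ
open import Data.Product.Base using (∃; ∃₂; _×_; _,_; proj₁; proj₂)
open import Data.Sum.Base as Sum using (_⊎_; inj₁; inj₂; [_,_])
import Data.Vec.Base as Vec
open import Data.Vec.Properties using (lookup∘tabulate; lookup⇒[]=; []=⇒lookup)
open import Function.Base using (_∘_; id)
open import Function.Bundles using (_⇔_; mk⇔; Equivalence)
open import Level using (Level; 0ℓ; _⊔_)
open import Relation.Binary.Core using (Rel)
import Relation.Binary.Definitions as Binary
open import Relation.Binary.PropositionalEquality
  using (_≡_; _≢_; refl; sym; trans; cong; subst)
import Relation.Binary.Reasoning.Setoid as SetoidReasoning
open import Relation.Binary.Structures using (IsEquivalence)
open import Relation.Nullary.Decidable
  using (Dec; yes; no; does; _×-dec_; _⊎-dec_; ¬?; dec-true; does-⇔; decidable-stable)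
open import Relation.Nullary.Negation using (¬_; contradiction)
open import Relation.Unary using (Pred; Decidable; _≐_)

open Equivalence using (to; from)

-- First elements of lists, and decisions as booleans.

firstOr : {A : Set} → A → List A → A
firstOr d []      = d
firstOr d (x ∷ _) = x

firstOr-∈ : {A : Set} {d x : A} {xs : List A} → x ∈ xs → firstOr d xs ∈ xs
firstOr-∈ (here _)  = here refl
firstOr-∈ (there _) = here refl

firstOr-irrelevant : {A : Set} {d d′ x : A} {xs : List A} → x ∈ xs →
                     firstOr d xs ≡ firstOr d′ xs
firstOr-irrelevant (here _)  = refl
firstOr-irrelevant (there _) = refl

T-does : {P : Set} (P? : Dec P) → T (does P?) ⇔ P
T-does (yes p) = mk⇔ (λ _ → p) _
T-does (no ¬p) = mk⇔ (λ ()) ¬p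

-- The set partition and the coloring given by an equivalence relation.

module Quotient {n} {_∼_ : Rel (Fin n) 0ℓ}
                (isEquivalence : IsEquivalence _∼_) (_∼?_ : Binary.Decidable _∼_) where

  private module ∼ = IsEquivalence isEquivalence

  classList : Fin n → List (Fin n)
  classList i = filter (i ∼?_) (allFin n)

  self∈classList : ∀ i → i ∈ classList i
  self∈classList i = ∈-filter⁺ (i ∼?_) (∈-allFin i) ∼.refl

  representative : Fin n → Fin n
  representative i = firstOr i (classList i)

  ∼-representative : ∀ i → i ∼ representative i
  ∼-representative i =
    proj₂ (∈-filter⁻ (i ∼?_) {xs = allFin n} (firstOr-∈ (self∈classList i)))

  -- Equivalent elements filter out the same list. Their defaults in `firstOr` differ, but a class
  -- contains its own element, so no default is ever returned.
  representative-cong : ∀ {i j} → i ∼ j → representative i ≡ representative j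
  representative-cong {i} {j} i∼j =
    trans (cong (firstOr i) (filter-≐ (i ∼?_) (j ∼?_)
            (∼.trans (∼.sym i∼j) , ∼.trans i∼j) (allFin n)))
          (firstOr-irrelevant (self∈classList j))

  representative-injective : ∀ {i j} → representative i ≡ representative j → i ∼ j
  representative-injective {i} {j} eq =
    ∼.trans (∼-representative i) (subst (_∼ j) (sym eq) (∼.sym (∼-representative j)))

  class : Fin n → Subset n
  class i = Vec.tabulate λ j → does (i ∼? j)

  ∈-class : ∀ {i j} → j ∈ˢ class i ⇔ i ∼ j
  ∈-class {i} {j} = mk⇔
    (λ j∈ → to (T-does (i ∼? j)) (from T-≡ (trans (sym (lookup∘tabulate _ j)) ([]=⇒lookup j∈))))
    (λ i∼j → lookup⇒[]= j _ (trans (lookup∘tabulate _ j) (dec-true (i ∼? j) i∼j)))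

  isRepresentative? : ∀ i → Dec (representative i ≡ i)
  isRepresentative? i = representative i Fin.≟ i

  representatives : List (Fin n)
  representatives = filter isRepresentative? (allFin n)

  ∈-ownClass : ∀ i → representative i ∈ representatives × i ∈ˢ class (representative i)
  ∈-ownClass i =
      ∈-filter⁺ isRepresentative? (∈-allFin _)
        (representative-cong (∼.sym (∼-representative i)))
    , from ∈-class (∼.sym (∼-representative i))

  -- Keeping only the fixed points of `representative` lists each class once, as the pairwise
  -- disjointness of the blocks requires.
  partition : SetPartition n
  partition = record
    { blocks   = map class representatives
    ; nonempty = All.map⁺ (All.tabulate λ {i} _ → i , from ∈-class ∼.refl)
    ; disjoint = AllPairs.map⁺ (disjointClasses representatives
                   (All.all-filter isRepresentative? (allFin n))
                   (AllPairs.filter⁺ isRepresentative? (allFin⁺ n)))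
    ; covering = λ i → lose (∈-map⁺ class (proj₁ (∈-ownClass i))) (proj₂ (∈-ownClass i))
    }
    where
    distinctDisjoint : ∀ {r s} → representative r ≡ r → representative s ≡ s →
                       r ≢ s → Empty (class r ∩ class s)
    distinctDisjoint {r} {s} r≡ s≡ r≢s (i , i∈) with x∈p∩q⁻ (class r) (class s) i∈
    ... | i∈r , i∈s = r≢s (trans (sym r≡) (trans (representative-cong
            (∼.trans (to ∈-class i∈r) (∼.sym (to ∈-class i∈s)))) s≡))

    disjointClasses : ∀ rs → All (λ r → representative r ≡ r) rs → AllPairs _≢_ rs →
                      AllPairs (λ r s → Empty (class r ∩ class s)) rs
    disjointClasses []       _        _            = AllPairs.[]
    disjointClasses (r ∷ rs) (p ∷ ps) (q AllPairs.∷ qs) =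
      All.zipWith (λ (s≡ , r≢s) → distinctDisjoint p s≡ r≢s) (ps , q)
      AllPairs.∷ disjointClasses rs ps qs

  partition-sameBlock : ∀ {i j} → SameBlock partition i j ⇔ i ∼ j
  partition-sameBlock {i} {j} = mk⇔ sound complete
    where
    sound : SameBlock partition i j → i ∼ j
    sound same with find same
    ... | B , B∈ , i∈ , j∈ with ∈-map⁻ class B∈
    ... | r , _ , refl = ∼.trans (∼.sym (to ∈-class i∈)) (to ∈-class j∈)

    complete : i ∼ j → SameBlock partition i j
    complete i∼j = lose (∈-map⁺ class (proj₁ (∈-ownClass i)))
      (proj₂ (∈-ownClass i) , from ∈-class (∼.trans (∼.sym (∼-representative i)) i∼j))

  color : Coloring n
  color i = toℕ (representative i)

  color≡ : ∀ {i j} → color i ≡ color j ⇔ i ∼ j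
  color≡ = mk⇔ (representative-injective ∘ Fin.toℕ-injective)
               (cong toℕ ∘ representative-cong)

-- Pairs of vertices and insertion of edges.

Edge : ℕ → Set
Edge n = ∃₂ λ (i j : Fin n) → i ≢ j

edgesBetween : ∀ {n} → Fin n → Fin n → List (Edge n)
edgesBetween i j with i Fin.≟ j
... | yes _  = []
... | no i≢j = (i , j , i≢j) ∷ []

-- Both orders of each pair occur, so the two pairs of a cherry can be taken with the common vertex
-- first. A distribution that separates the two orders of a pair violates `Avoids` below.
allEdges : ∀ n → List (Edge n)
allEdges n = concatMap (λ i → concatMap (edgesBetween i) (allFin n)) (allFin n)

-- The inequality proofs carried by edges are not unique, so membership of the
-- pair ij in a list of edges leaves the proof open.

infix 4 _,_∈ᴱ_

_,_∈ᴱ_ : ∀ {n} → Fin n → Fin n → List (Edge n) → Set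
i , j ∈ᴱ es = ∃ λ i≢j → (i , j , i≢j) ∈ es

∈-edgesBetween : ∀ {n} {i j : Fin n} → i ≢ j → i , j ∈ᴱ edgesBetween i j
∈-edgesBetween {i = i} {j} i≢j with i Fin.≟ j
... | yes i≡j = contradiction i≡j i≢j
... | no i≢j  = i≢j , here refl

∈-allEdges : ∀ {n} {i j : Fin n} → i ≢ j → i , j ∈ᴱ allEdges n
∈-allEdges {n} {i} {j} i≢j with e , e∈ ← ∈-edgesBetween i≢j =
  e , ∈-concatMap⁺ _ (lose (∈-allFin i) (∈-concatMap⁺ _ (lose (∈-allFin j) e∈)))

insert : ∀ {n} → Graph n → Edge n → Graph n
insert G (i , j , i≢j) = addEdge G i j i≢j

insertAll : ∀ {n} → Graph n → List (Edge n) → Graph n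
insertAll G []       = G
insertAll G (e ∷ es) = insert (insertAll G es) e

edgeless : ∀ {n} → Graph n
edgeless = record
  { adj = λ _ _ → false ; symmetric = λ _ _ → refl ; irreflexive = λ _ → refl }

infix 4 _≗ᴳ_ _⊆ᴳ_

_≗ᴳ_ _⊆ᴳ_ : ∀ {n} → Rel (Graph n) 0ℓ
G ≗ᴳ H = ∀ i j → adj G i j ≡ adj H i j
G ⊆ᴳ H = ∀ {i j} → Adjacent G i j → Adjacent H i j

module _ {n} (G : Graph n) where

  adjacent-sym : ∀ {i j} → Adjacent G i j → Adjacent G j i
  adjacent-sym {i} {j} = subst T (Graph.symmetric G i j)

  ⊆-antisym : ∀ {H : Graph n} → G ⊆ᴳ H → H ⊆ᴳ G → G ≗ᴳ H
  ⊆-antisym {H} G⊆H H⊆G i j =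
    does-⇔ (mk⇔ (G⊆H {i} {j}) H⊆G) (T? (adj G i j)) (T? (adj H i j))

  insert-adjacent : ∀ (e@(i , j , _) : Edge n) {a b} →
    Adjacent (insert G e) a b ⇔ (Adjacent G a b ⊎ (a ≡ i × b ≡ j) ⊎ (a ≡ j × b ≡ i))
  insert-adjacent (i , j , _) {a} {b} = T-does
    (T? (adj G a b) ⊎-dec
     ((a Fin.≟ i ×-dec b Fin.≟ j) ⊎-dec (a Fin.≟ j ×-dec b Fin.≟ i)))

  insert-⊇ : ∀ e → G ⊆ᴳ insert G e
  insert-⊇ e {i} {j} = from (insert-adjacent e {i} {j}) ∘ inj₁

  insert-endpoints : ∀ (e@(i , j , _) : Edge n) → Adjacent (insert G e) i j
  insert-endpoints e = from (insert-adjacent e) (inj₂ (inj₁ (refl , refl)))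

  insert-idempotent : ∀ (e@(i , j , _) : Edge n) → Adjacent G i j → insert G e ≗ᴳ G
  insert-idempotent e ij a b =
    sym (⊆-antisym {insert G e} (λ {a} → insert-⊇ e {a}) (λ {a} → insert-⊆ {a}) a b)
    where
    insert-⊆ : insert G e ⊆ᴳ G
    insert-⊆ ab with to (insert-adjacent e) ab
    ... | inj₁ ab′                  = ab′
    ... | inj₂ (inj₁ (refl , refl)) = ij
    ... | inj₂ (inj₂ (refl , refl)) = adjacent-sym ij

  insert-comm : ∀ e e′ → insert (insert G e) e′ ≗ᴳ insert (insert G e′) e
  insert-comm (i , j , _) (k , l , _) a b =
    trans (∨-assoc (adj G a b) (isEdge i j a b) (isEdge k l a b))
    (trans (cong (adj G a b ∨_) (∨-comm (isEdge i j a b) (isEdge k l a b)))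
           (sym (∨-assoc (adj G a b) (isEdge k l a b) (isEdge i j a b))))

  -- The colorings lost on inserting `e` are those constant on `e`; this is why each difference in
  -- an alternating sum imposes an equality of colors.
  insert-proper : ∀ (e@(i , j , _) : Edge n) {f} → Proper (insert G e) f ⇔ (Proper G f × f i ≢ f j)
  insert-proper e@(i , j , _) {f} = mk⇔
    (λ P → (λ a b → P a b ∘ insert-⊇ e) , P i j (insert-endpoints e))
    (λ (P , i≢j) a b ab → case P i≢j (to (insert-adjacent e) ab))
    where
    case : ∀ {a b} → Proper G f → f i ≢ f j →
           Adjacent G a b ⊎ (a ≡ i × b ≡ j) ⊎ (a ≡ j × b ≡ i) → f a ≢ f b
    case P i≢j (inj₁ ab)                   = P _ _ ab
    case P i≢j (inj₂ (inj₁ (refl , refl))) = i≢j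
    case P i≢j (inj₂ (inj₂ (refl , refl))) = i≢j ∘ sym

module _ {n} (G : Graph n) where

  -- Splits off the part that does not depend on `G`, which is the graph `H` of a leaf.
  insertAll-∨ : ∀ es a b → adj (insertAll G es) a b ≡ adj G a b ∨ adj (insertAll edgeless es) a b
  insertAll-∨ []               a b = sym (trans (∨-comm (adj G a b) false) refl)
  insertAll-∨ ((i , j , _) ∷ es) a b =
    trans (cong (_∨ isEdge i j a b) (insertAll-∨ es a b))
          (∨-assoc (adj G a b) (adj (insertAll edgeless es) a b) (isEdge i j a b))

  insertAll-adjacent : ∀ es {a b} → Adjacent (insertAll G es) a b ⇔
                       (Adjacent G a b ⊎ Adjacent (insertAll edgeless es) a b)
  insertAll-adjacent es {a} {b} =
    subst (λ x → T x ⇔ (Adjacent G a b ⊎ Adjacent (insertAll edgeless es) a b))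
          (sym (insertAll-∨ es a b)) T-∨

  ∈⇒insertAll-adjacent : ∀ {i j es} → i , j ∈ᴱ es → Adjacent (insertAll G es) i j
  ∈⇒insertAll-adjacent {es = e ∷ es} (_ , here refl) = insert-endpoints (insertAll G es) e
  ∈⇒insertAll-adjacent {es = e ∷ es} (i≢j , there e∈) =
    insert-⊇ (insertAll G es) e (∈⇒insertAll-adjacent (i≢j , e∈))

-- Submodules, spans and congruences.

module Submodules {r ℓr m ℓm : Level} (R : CommutativeRing r ℓr) (M : Module R m ℓm) where

  private module R = CommutativeRing R
  open Module M
  open ModuleProperties M using (inverseʳ-uniqueᴹ)
  open AbelianGroupProperties +ᴹ-abelianGroup using (⁻¹-∙-comm; ⁻¹-involutive)
  open CommutativeSemigroupProperties
    (CommutativeMonoid.commutativeSemigroup +ᴹ-commutativeMonoid)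
    using (interchange) public
  open SetoidReasoning ≈ᴹ-setoid
  open LinearAlgebra R using (Span; linearCombination)

  -- Inverses are unique, and `x` plus its multiple by -1 is its multiple by 0. Closure under
  -- scaling thus gives closure under negation.
  -ᴹ≈-1*ₗ : ∀ x → -ᴹ x ≈ᴹ (R.- R.1#) *ₗ x
  -ᴹ≈-1*ₗ x = ≈ᴹ-sym (inverseʳ-uniqueᴹ x _ (begin
    x +ᴹ (R.- R.1#) *ₗ x           ≈⟨ +ᴹ-congʳ (*ₗ-identityˡ x) ⟨
    R.1# *ₗ x +ᴹ (R.- R.1#) *ₗ x   ≈⟨ *ₗ-distribʳ x R.1# (R.- R.1#) ⟨
    (R.1# R.+ R.- R.1#) *ₗ x       ≈⟨ *ₗ-congʳ (R.-‿inverseʳ R.1#) ⟩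
    R.0# *ₗ x                      ≈⟨ *ₗ-zeroˡ x ⟩
    0ᴹ                             ∎))

  x+[y-x]≈y : ∀ x y → x +ᴹ (y +ᴹ -ᴹ x) ≈ᴹ y
  x+[y-x]≈y x y = begin
    x +ᴹ (y +ᴹ -ᴹ x)   ≈⟨ +ᴹ-congˡ (+ᴹ-comm y (-ᴹ x)) ⟩
    x +ᴹ (-ᴹ x +ᴹ y)   ≈⟨ +ᴹ-assoc x (-ᴹ x) y ⟨
    (x +ᴹ -ᴹ x) +ᴹ y   ≈⟨ +ᴹ-congʳ (-ᴹ‿inverseʳ x) ⟩
    0ᴹ +ᴹ y            ≈⟨ +ᴹ-identityˡ y ⟩
    y                  ∎

  -- Exchanges two successive differences, for the invariance of `alternating` under permutations.
  [w-x]-[y-z]≈[w-y]-[x-z] : ∀ w x y z →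
    (w +ᴹ -ᴹ x) +ᴹ -ᴹ (y +ᴹ -ᴹ z) ≈ᴹ (w +ᴹ -ᴹ y) +ᴹ -ᴹ (x +ᴹ -ᴹ z)
  [w-x]-[y-z]≈[w-y]-[x-z] w x y z = begin
    (w +ᴹ -ᴹ x) +ᴹ -ᴹ (y +ᴹ -ᴹ z)      ≈⟨ +ᴹ-congˡ (⁻¹-∙-comm y (-ᴹ z)) ⟨
    (w +ᴹ -ᴹ x) +ᴹ (-ᴹ y +ᴹ -ᴹ -ᴹ z)   ≈⟨ interchange w (-ᴹ x) (-ᴹ y) (-ᴹ -ᴹ z) ⟩
    (w +ᴹ -ᴹ y) +ᴹ (-ᴹ x +ᴹ -ᴹ -ᴹ z)   ≈⟨ +ᴹ-congˡ (⁻¹-∙-comm x (-ᴹ z)) ⟩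
    (w +ᴹ -ᴹ y) +ᴹ -ᴹ (x +ᴹ -ᴹ z)      ∎

  -- The left side has the form of an alternating sum over two pairs, the right side that of
  -- `modularRelation`.
  [w-x]-[y-z]≈w-y-x+z : ∀ w x y z →
    (w +ᴹ -ᴹ x) +ᴹ -ᴹ (y +ᴹ -ᴹ z) ≈ᴹ ((w +ᴹ -ᴹ y) +ᴹ -ᴹ x) +ᴹ z
  [w-x]-[y-z]≈w-y-x+z w x y z = begin
    (w +ᴹ -ᴹ x) +ᴹ -ᴹ (y +ᴹ -ᴹ z)      ≈⟨ [w-x]-[y-z]≈[w-y]-[x-z] w x y z ⟩
    (w +ᴹ -ᴹ y) +ᴹ -ᴹ (x +ᴹ -ᴹ z)      ≈⟨ +ᴹ-congˡ (⁻¹-∙-comm x (-ᴹ z)) ⟨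
    (w +ᴹ -ᴹ y) +ᴹ (-ᴹ x +ᴹ -ᴹ -ᴹ z)   ≈⟨ +ᴹ-congˡ (+ᴹ-congˡ (⁻¹-involutive z)) ⟩
    (w +ᴹ -ᴹ y) +ᴹ (-ᴹ x +ᴹ z)         ≈⟨ +ᴹ-assoc _ _ _ ⟨
    ((w +ᴹ -ᴹ y) +ᴹ -ᴹ x) +ᴹ z         ∎

  record IsSubmodule {p} (P : Pred Carrierᴹ p) : Set (r ⊔ m ⊔ ℓm ⊔ p) where
    field
      resp       : ∀ {x y} → x ≈ᴹ y → P x → P y
      0-closed   : P 0ᴹ
      +-closed   : ∀ {x y} → P x → P y → P (x +ᴹ y)
      *ₗ-closed  : ∀ a {x} → P x → P (a *ₗ x)

    neg-closed : ∀ {x} → P x → P (-ᴹ x)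
    neg-closed {x} px = resp (≈ᴹ-sym (-ᴹ≈-1*ₗ x)) (*ₗ-closed _ px)

  module _ {i} {I : Set i} (v : I → Carrierᴹ) where

    linearCombination-++ : ∀ cs ds → linearCombination M v (cs ++ ds) ≈ᴹ
                                     linearCombination M v cs +ᴹ linearCombination M v ds
    linearCombination-++ []       ds = ≈ᴹ-sym (+ᴹ-identityˡ _)
    linearCombination-++ (c ∷ cs) ds =
      ≈ᴹ-trans (+ᴹ-congˡ (linearCombination-++ cs ds)) (≈ᴹ-sym (+ᴹ-assoc _ _ _))

    linearCombination-* : ∀ a cs → ∃ λ ds →
                          a *ₗ linearCombination M v cs ≈ᴹ linearCombination M v ds
    linearCombination-* a [] = [] , *ₗ-zeroʳ a
    linearCombination-* a ((c , i) ∷ cs) with ds , eq ← linearCombination-* a cs =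
      (a R.* c , i) ∷ ds ,
      ≈ᴹ-trans (*ₗ-distribˡ a _ _) (+ᴹ-cong (≈ᴹ-sym (*ₗ-assoc a c _)) eq)

    Span-isSubmodule : IsSubmodule (Span M v)
    Span-isSubmodule = record
      { resp      = λ x≈y (cs , x≈) → cs , ≈ᴹ-trans (≈ᴹ-sym x≈y) x≈
      ; 0-closed  = [] , ≈ᴹ-refl
      ; +-closed  = λ (cs , x≈) (ds , y≈) →
          cs ++ ds , ≈ᴹ-trans (+ᴹ-cong x≈ y≈) (≈ᴹ-sym (linearCombination-++ cs ds))
      ; *ₗ-closed = λ a (cs , x≈) → let ds , eq = linearCombination-* a cs in
          ds , ≈ᴹ-trans (*ₗ-congˡ x≈) eq
      }

    Span-generator : ∀ i → Span M v (v i)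
    Span-generator i =
      (R.1# , i) ∷ [] , ≈ᴹ-sym (≈ᴹ-trans (+ᴹ-identityʳ _) (*ₗ-identityˡ _))

    -- Reduces the inclusions of the two spans, one in the kernel and one in the image, to their
    -- generators.
    Span-least : ∀ {p} {P : Pred Carrierᴹ p} → IsSubmodule P → (∀ i → P (v i)) →
                 ∀ {x} → Span M v x → P x
    Span-least {P = P} isSubmodule pv (cs , x≈) = P.resp (≈ᴹ-sym x≈) (closed cs)
      where
      module P = IsSubmodule isSubmodule
      closed : ∀ cs → P (linearCombination M v cs)
      closed []             = P.0-closed
      closed ((c , i) ∷ cs) = P.+-closed (P.*ₗ-closed c (pv i)) (closed cs)

  module Congruence {p} {P : Pred Carrierᴹ p} (isSubmodule : IsSubmodule P) where

    private module P = IsSubmodule isSubmodule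

    infix 4 _∼_

    _∼_ : Rel Carrierᴹ (m ⊔ ℓm ⊔ p)
    x ∼ y = ∃ λ z → P z × x ≈ᴹ y +ᴹ z

    ∼-reflexive : ∀ {x y} → x ≈ᴹ y → x ∼ y
    ∼-reflexive x≈y = 0ᴹ , P.0-closed , ≈ᴹ-trans x≈y (≈ᴹ-sym (+ᴹ-identityʳ _))

    ∼-resp : ∀ {x x′ y y′} → x ≈ᴹ x′ → y ≈ᴹ y′ → x ∼ y → x′ ∼ y′
    ∼-resp x≈ y≈ (z , pz , eq) = z , pz , ≈ᴹ-trans (≈ᴹ-sym x≈) (≈ᴹ-trans eq (+ᴹ-congʳ y≈))

    ∼-+ : ∀ {x x′ y y′} → x ∼ y → x′ ∼ y′ → x +ᴹ x′ ∼ y +ᴹ y′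
    ∼-+ (z , pz , eq) (z′ , pz′ , eq′) =
      z +ᴹ z′ , P.+-closed pz pz′ , ≈ᴹ-trans (+ᴹ-cong eq eq′) (interchange _ _ _ _)

    ∼-* : ∀ a {x y} → x ∼ y → a *ₗ x ∼ a *ₗ y
    ∼-* a (z , pz , eq) =
      a *ₗ z , P.*ₗ-closed a pz , ≈ᴹ-trans (*ₗ-congˡ eq) (*ₗ-distribˡ a _ _)

    ∈⇒∼ : ∀ {x y} → P x → P y → x ∼ y
    ∈⇒∼ {x} {y} px py =
      x +ᴹ -ᴹ y , P.+-closed px (P.neg-closed py) , ≈ᴹ-sym (x+[y-x]≈y y x)

    ∼0⇒∈ : ∀ {x} → x ∼ 0ᴹ → P x
    ∼0⇒∈ (z , pz , eq) = P.resp (≈ᴹ-sym (≈ᴹ-trans eq (+ᴹ-identityˡ z))) pz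

  -- Sums over the distributions of a list between two lists.

  splitSum : ∀ {a} {A : Set a} → List A → (List A → List A → Carrierᴹ) → Carrierᴹ
  splitSum []       F = F [] []
  splitSum (x ∷ xs) F = splitSum xs (λ is os → F (x ∷ is) os) +ᴹ
                        splitSum xs (λ is os → F is (x ∷ os))

  module _ {a} {A : Set a} where

    Covers : List A → List A → List A → Set a
    Covers xs is os = ∀ {x} → x ∈ xs → x ∈ is ⊎ x ∈ os

    -- Any relation compatible with addition is allowed, so that one induction serves for equality,
    -- for congruence modulo modular relations and for membership in `WSym`.
    splitSum-rel : ∀ {ℓ} {_≈_ : Rel Carrierᴹ ℓ} →
      (∀ {x x′ y y′} → x ≈ y → x′ ≈ y′ → (x +ᴹ x′) ≈ (y +ᴹ y′)) →
      ∀ xs {F F′} → (∀ is os → Covers xs is os → F is os ≈ F′ is os) →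
      splitSum xs F ≈ splitSum xs F′
    splitSum-rel             +-rel []       F≈ = F≈ [] [] λ ()
    splitSum-rel {_≈_ = _≈_} +-rel (x ∷ xs) F≈ = +-rel
      (splitSum-rel {_≈_ = _≈_} +-rel xs λ is os c → F≈ (x ∷ is) os
        λ { (here refl) → inj₁ (here refl) ; (there y∈) → Sum.map₁ there (c y∈) })
      (splitSum-rel {_≈_ = _≈_} +-rel xs λ is os c → F≈ is (x ∷ os)
        λ { (here refl) → inj₂ (here refl) ; (there y∈) → Sum.map₂ there (c y∈) })

    splitSum-cong : ∀ (xs : List A) {F F′} → (∀ is os → F is os ≈ᴹ F′ is os) →
                    splitSum xs F ≈ᴹ splitSum xs F′
    splitSum-cong xs F≈ = splitSum-rel {_≈_ = _≈ᴹ_} +ᴹ-cong xs λ is os _ → F≈ is os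

    splitSum-+ : ∀ (xs : List A) F F′ → splitSum xs (λ is os → F is os +ᴹ F′ is os) ≈ᴹ
                             splitSum xs F +ᴹ splitSum xs F′
    splitSum-+ []       F F′ = ≈ᴹ-refl
    splitSum-+ (x ∷ xs) F F′ =
      ≈ᴹ-trans (+ᴹ-cong (splitSum-+ xs _ _) (splitSum-+ xs _ _)) (interchange _ _ _ _)

    splitSum-* : ∀ (xs : List A) a F → splitSum xs (λ is os → a *ₗ F is os) ≈ᴹ a *ₗ splitSum xs F
    splitSum-* []       a F = ≈ᴹ-refl
    splitSum-* (x ∷ xs) a F =
      ≈ᴹ-trans (+ᴹ-cong (splitSum-* xs a _) (splitSum-* xs a _)) (≈ᴹ-sym (*ₗ-distribˡ a _ _))

    splitSum-0 : ∀ (xs : List A) {F} → (∀ is os → F is os ≈ᴹ 0ᴹ) → splitSum xs F ≈ᴹ 0ᴹ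
    splitSum-0 []       F≈0 = F≈0 [] []
    splitSum-0 (x ∷ xs) F≈0 = ≈ᴹ-trans
      (+ᴹ-cong (splitSum-0 xs λ is os → F≈0 (x ∷ is) os) (splitSum-0 xs λ is os → F≈0 is (x ∷ os)))
      (+ᴹ-identityˡ 0ᴹ)

extract : ∀ {a} {A : Set a} {x : A} {xs} → x ∈ xs → ∃ λ ys → xs ↭ x ∷ ys
extract {x = x} x∈ with ys , zs , refl ← ∈-∃++ x∈ = ys ++ zs , shift x ys zs

-- Graphs and lists of pairs that encode a set partition.

Monochromatic : ∀ {n} → Coloring n → Edge n → Set
Monochromatic f (i , j , _) = f i ≡ f j

monochromatic? : ∀ {n} (f : Coloring n) → Decidable (Monochromatic f)
monochromatic? f (i , j , _) = f i ℕ.≟ f j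

record Realizes {n} (π : SetPartition n) (H : Graph n) (O : List (Edge n)) : Set where
  field
    adjacent⇔ : ∀ {i j} → Adjacent H i j ⇔ (¬ SameBlock π i j)
    O-sound   : ∀ {i j} → i , j ∈ᴱ O → SameBlock π i j
    O-full    : ∀ {i j} → i ≢ j → SameBlock π i j → i , j ∈ᴱ O

  -- Properness on `H` separates the blocks, and constancy on the pairs in `O` makes each block
  -- monochromatic.
  hasKernel : ∀ {f} → HasKernel π f ⇔ (Proper H f × All (Monochromatic f) O)
  hasKernel {f} = mk⇔
    (λ ker → (λ i j ij → to adjacent⇔ ij ∘ to (ker i j))
           , All.tabulate λ e∈ → from (ker _ _) (O-sound (_ , e∈)))
    (λ (proper , mono) i j → mk⇔
      (λ fi≡fj → decidable-stable (sameBlock? π i j) λ i≁j → proper i j (from adjacent⇔ i≁j) fi≡fj)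
      (same mono))
    where
    same : All (Monochromatic f) O → ∀ {i j} → SameBlock π i j → f i ≡ f j
    same mono {i} {j} i∼j with i Fin.≟ j
    ... | yes refl = refl
    ... | no i≢j   = All.lookup mono (proj₂ (O-full i≢j i∼j))

module _ {n} (π : SetPartition n) where

  sameBlock-refl : ∀ i → SameBlock π i i
  sameBlock-refl i with B , B∈ , i∈ ← find (SetPartition.covering π i) = lose B∈ (i∈ , i∈)

  sameBlock-sym : ∀ {i j} → SameBlock π i j → SameBlock π j i
  sameBlock-sym i∼j with B , B∈ , i∈ , j∈ ← find i∼j = lose B∈ (j∈ , i∈)

  multipartite : Graph n
  multipartite = record
    { adj         = λ i j → not (does (sameBlock? π i j))
    ; symmetric   = λ i j → cong not
        (does-⇔ (mk⇔ sameBlock-sym sameBlock-sym) (sameBlock? π i j) (sameBlock? π j i))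
    ; irreflexive = λ i → cong not (dec-true (sameBlock? π i i) (sameBlock-refl i))
    }

  withinBlock? : Decidable λ ((i , j , _) : Edge n) → SameBlock π i j
  withinBlock? (i , j , _) = sameBlock? π i j

  -- Supplies the explicit preimage of `𝐦` at `π`.
  multipartite-realizes : Realizes π multipartite (filter withinBlock? (allEdges n))
  multipartite-realizes = record
    { adjacent⇔ = λ {i} {j} → T-does (¬? (sameBlock? π i j))
    ; O-sound   = λ (_ , e∈) → proj₂ (∈-filter⁻ withinBlock? {xs = allEdges n} e∈)
    ; O-full    = λ i≢j i∼j → let p , e∈ = ∈-allEdges i≢j in p , ∈-filter⁺ withinBlock? e∈ i∼j
    }

-- One distribution of the pairs of vertices between I and O.

module Leaf {n} (I O : List (Edge n)) where

  H : Graph n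
  H = insertAll edgeless I

  Avoids : Set
  Avoids = ¬ Any (λ (i , j , _) → Adjacent H i j) O

  -- A failure of transitivity of nonadjacency. The three vertices are automatically distinct: if
  -- `i` were `j` or `k`, the edge `jk` would be one of the two missing pairs.
  Cherry : Set
  Cherry = ∃ λ i → ∃₂ λ j k → ¬ Adjacent H i j × ¬ Adjacent H i k × Adjacent H j k

  avoids? : Dec Avoids
  avoids? = ¬? (any? (λ (i , j , _) → T? (adj H i j)) O)

  cherry? : Dec Cherry
  cherry? = Fin.any? λ i → Fin.any? λ j → Fin.any? λ k →
    ¬? (T? (adj H i j)) ×-dec (¬? (T? (adj H i k)) ×-dec T? (adj H j k))

  Valid : Set
  Valid = Avoids × ¬ Cherry

  valid? : Dec Valid
  valid? = avoids? ×-dec ¬? cherry?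

  module _ (valid : Valid) where

    nonadjacency-isEquivalence : IsEquivalence (λ i j → ¬ Adjacent H i j)
    nonadjacency-isEquivalence = record
      { refl  = λ {i} → subst T (Graph.irreflexive H i)
      ; sym   = λ i≁j → i≁j ∘ adjacent-sym H
      -- Here `i≁k` is an adjacency, and the middle vertex `j` would be the center of a cherry.
      ; trans = λ i∼j j∼k i≁k →
          proj₂ valid (_ , _ , _ , i∼j ∘ adjacent-sym H , j∼k , i≁k)
      }

    open Quotient nonadjacency-isEquivalence (λ i j → ¬? (T? (adj H i j))) public

    -- Pairs in `I` are edges of `H`, so a nonadjacent pair can only lie in `O`; conversely `Avoids`
    -- makes every pair in `O` nonadjacent.
    partition-realizes : (∀ {i j} → i ≢ j → i , j ∈ᴱ I ⊎ i , j ∈ᴱ O) → Realizes partition H O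
    partition-realizes cover = record
      { adjacent⇔ = λ {i} {j} → mk⇔ (λ ij same → to partition-sameBlock same ij)
          (λ i≁j → decidable-stable (T? (adj H i j)) (i≁j ∘ from partition-sameBlock))
      ; O-sound   = λ (_ , e∈) → from partition-sameBlock λ ij → proj₁ valid (lose e∈ ij)
      ; O-full    = λ i≢j i∼j →
          [ (λ e∈I → contradiction (∈⇒insertAll-adjacent edgeless e∈I) (to partition-sameBlock i∼j))
          , id ] (cover i≢j)
      }

  -- The constant on an invalid leaf is arbitrary: the alternating sum there is modular, whatever
  -- coefficient it gets.
  coloring : Coloring n
  coloring with valid?
  ... | yes valid = color valid
  ... | no _      = λ _ → 0

  coloring≡ : Valid → ∀ {i j} → coloring i ≡ coloring j ⇔ (¬ Adjacent H i j)
  coloring≡ valid with valid?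
  ... | yes valid′ = color≡ valid′
  ... | no ¬valid  = contradiction valid ¬valid

module Chromatic {c ℓ₁ ℓ₂ : Level} (K : HeytingField c ℓ₁ ℓ₂) where

  private
    module K = CommutativeRing (scalars K)
    module 𝐆ᴹ = Module (𝐆 K)
    module 𝐒ᴹ = Module (series K)
    module 𝐒 = Submodules (scalars K) (series K)

  open LinearAlgebra (scalars K)
  open Free graphSetoid
  open Submodules (scalars K) (𝐆 K)
  open RingProperties K.ring using (-0#≈0#)

  Modular : Pred Expr _
  Modular = Span (𝐆 K) (modularRelation K)

  Modular-isSubmodule : IsSubmodule Modular
  Modular-isSubmodule = Span-isSubmodule (modularRelation K)

  private module Mod = IsSubmodule Modular-isSubmodule
  open Congruence Modular-isSubmodule

  -- Alternating sums and modular relations.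

  ⊖-cancel : ∀ {x y} → x ≋ y → x ⊕ ⊖ y ≋ 𝟎
  ⊖-cancel x≋y = ≋-trans (⊕-cong x≋y ≋-refl) (𝐆ᴹ.-ᴹ‿inverseʳ _)

  -- Σ (-1)^|S| (G ∪ S) over the subsets S of O.

  alternating : ∀ {n} → List (Edge n) → Graph n → Expr
  alternating []      G = gen (_ , G)
  alternating (e ∷ O) G = alternating O G ⊕ ⊖ alternating O (insert G e)

  alternating-cong : ∀ {n} (O : List (Edge n)) {G H} → G ≗ᴳ H → alternating O G ≋ alternating O H
  alternating-cong []                G≗H = gen-cong (sameEdges G≗H)
  alternating-cong ((i , j , _) ∷ O) G≗H =
    ⊕-cong (alternating-cong O G≗H)
           (⊖-cong (alternating-cong O λ a b → cong (_∨ isEdge i j a b) (G≗H a b)))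

  -- A swap exchanges two successive differences and the order in which the two edges are inserted.
  alternating-↭ : ∀ {n} {O O′ : List (Edge n)} → O ↭ O′ → ∀ G → alternating O G ≋ alternating O′ G
  alternating-↭ ↭.refl       G = ≋-refl
  alternating-↭ (↭.prep e p) G = ⊕-cong (alternating-↭ p G) (⊖-cong (alternating-↭ p (insert G e)))
  alternating-↭ (↭.trans p q) G = ≋-trans (alternating-↭ p G) (alternating-↭ q G)
  alternating-↭ (↭.swap {xs = O} e e′ p) G = ≋-trans
    ([w-x]-[y-z]≈[w-y]-[x-z] _ _ _ _)
    (⊕-cong (⊕-cong (alternating-↭ p _) (⊖-cong (alternating-↭ p _)))
            (⊖-cong (⊕-cong (alternating-↭ p _)
                            (⊖-cong (≋-trans (alternating-cong O (insert-comm G e e′))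
                                             (alternating-↭ p _))))))

  -- With the pair moved to the front, inserting it changes nothing, so the two halves cancel.
  alternating-adjacent : ∀ {n} {O} {G : Graph n} {i j} → i , j ∈ᴱ O → Adjacent G i j →
                         alternating O G ≋ 𝟎
  alternating-adjacent {O = O} {G} (i≢j , e∈) ij with O′ , p ← extract e∈ = ≋-trans
    (alternating-↭ p G)
    (⊖-cancel (≋-sym (alternating-cong O′ (insert-idempotent G (_ , _ , i≢j) ij))))

  modularRelation≋alternating : ∀ t → let open ModularTriangle t in
    modularRelation K t ≋ alternating ((i , j , i≢j) ∷ (i , k , i≢k) ∷ []) graph
  modularRelation≋alternating t = ≋-sym ([w-x]-[y-z]≈w-y-x+z _ _ _ _)

  -- If one of the two pairs is already an edge, the sum vanishes; otherwise it is a modular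
  -- relation.
  cherry-Modular : ∀ {n} (G : Graph n) {i j k} i≢j i≢k → Adjacent G j k →
                   Modular (alternating ((i , j , i≢j) ∷ (i , k , i≢k) ∷ []) G)
  cherry-Modular G {i} {j} {k} i≢j i≢k jk with T? (adj G i j) | T? (adj G i k)
  ... | yes ij | _      = Mod.resp (≋-sym (alternating-adjacent (i≢j , here refl) ij)) Mod.0-closed
  ... | no _   | yes ik = Mod.resp (≋-sym (alternating-adjacent {O = (i , j , i≢j) ∷ _}
                                             (i≢k , there (here refl)) ik)) Mod.0-closed
  ... | no i≁j | no i≁k = Mod.resp (modularRelation≋alternating t)
                                   (Span-generator (modularRelation K) t)
    where
    t : ModularTriangle
    t = record
      { graph = G ; i = i ; j = j ; k = k ; i≢j = i≢j ; i≢k = i≢k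
      ; j≢k = λ { refl → subst T (Graph.irreflexive G j) jk }
      ; e₁∉ = i≁j ; e₂∉ = i≁k ; e₃∈ = jk }

  -- With the two pairs moved to the end, the other pairs only form signed sums of cherries over
  -- larger graphs, all of which still contain `jk`.
  alternating-Modular : ∀ {n} {O} {G : Graph n} {i j k} →
    i , j ∈ᴱ O → i , k ∈ᴱ O → Adjacent G j k → Modular (alternating O G)
  alternating-Modular {n} {O} {G} {i} {j} {k} (i≢j , ij∈) (i≢k , ik∈) jk
    with O₁ , p ← extract ij∈ with ∈-resp-↭ p ik∈
  -- If both memberships point to the same entry, then `jk` is a loop.
  ... | here refl = contradiction jk (subst T (Graph.irreflexive G j))
  ... | there ik∈′ with O₂ , q ← extract ik∈′ =
    Mod.resp (≋-sym (alternating-↭ (↭-trans p (↭-trans (↭.prep _ q) (++-comm cherry O₂))) G))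
             (closed O₂ G jk)
    where
    cherry : List (Edge n)
    cherry = (i , j , i≢j) ∷ (i , k , i≢k) ∷ []

    closed : ∀ O G → Adjacent G j k → Modular (alternating (O ++ cherry) G)
    closed []      G jk = cherry-Modular G i≢j i≢k jk
    closed (e ∷ O) G jk = Mod.+-closed (closed O G jk)
      (Mod.neg-closed (closed O (insert G e) (insert-⊇ G e jk)))

  -- A pair `e` contributes the term with `e` inserted when it goes to `I`, and the difference to
  -- the term without it when it goes to `O`; these add up to the term without `e`.
  gen-expansion : ∀ {n} (es : List (Edge n)) G →
                  gen (n , G) ≋ splitSum es λ I O → alternating O (insertAll G I)
  gen-expansion []       G = ≋-refl
  gen-expansion (e ∷ es) G = ≋-trans (gen-expansion es G) (≋-sym (≋-trans
    (≋-sym (splitSum-+ es _ _)) (splitSum-cong es λ I O → x+[y-x]≈y _ _)))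

  -- The missing pairs of a cherry in `H` are not in `I`, hence in `O`. They may become edges in
  -- `insertAll G I`; `alternating-Modular` asks only that `jk` be an edge there.
  invalid-Modular : ∀ {n I O} → Covers (allEdges n) I O → ¬ Leaf.Valid I O →
                    ∀ (G : Graph n) → Modular (alternating O (insertAll G I))
  invalid-Modular {n} {I} {O} covers ¬valid G with any? (λ (i , j , _) → T? (adj H i j)) O
    where open Leaf I O
  ... | yes meets with (i , j , i≢j) , e∈ , ij ← find meets = Mod.resp
    (≋-sym (alternating-adjacent (i≢j , e∈) (from (insertAll-adjacent G I) (inj₂ ij))))
    Mod.0-closed
  ... | no avoids with Leaf.cherry? I O
  ... | no ¬cherry = contradiction (avoids , ¬cherry) ¬valid
  ... | yes (i , j , k , i≁j , i≁k , jk) = alternating-Modular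
      (inO i≁j λ { refl → i≁k jk })
      (inO i≁k λ { refl → i≁j (adjacent-sym H jk) })
      (from (insertAll-adjacent G I) (inj₂ jk))
    where
    open Leaf I O
    inO : ∀ {a b} → ¬ Adjacent H a b → a ≢ b → a , b ∈ᴱ O
    inO a≁b a≢b with a≢b′ , e∈ ← ∈-allEdges a≢b with covers e∈
    ... | inj₁ e∈I = contradiction (∈⇒insertAll-adjacent edgeless (_ , e∈I)) a≁b
    ... | inj₂ e∈O = a≢b′ , e∈O

  -- Coefficients of the series of alternating sums.

  Indicates : ∀ {p} → Set p → K.Carrier → Set _
  Indicates P x = (P → x K.≈ K.1#) × (¬ P → x K.≈ K.0#)

  indicates-⇔ : ∀ {p q} {P : Set p} {Q : Set q} {x} → P ⇔ Q → Indicates P x → Indicates Q x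
  indicates-⇔ P⇔Q (is1 , is0) = is1 ∘ from P⇔Q , λ ¬q → is0 (¬q ∘ to P⇔Q)

  indicates-unique : ∀ {p} {P : Set p} {x y} → Dec P → Indicates P x → Indicates P y → x K.≈ y
  indicates-unique (yes p) (x≈1 , _) (y≈1 , _) = K.trans (x≈1 p) (K.sym (y≈1 p))
  indicates-unique (no ¬p) (_ , x≈0) (_ , y≈0) = K.trans (x≈0 ¬p) (K.sym (y≈0 ¬p))

  indicates-does : ∀ {P : Set} (P? : Dec P) → Indicates P (if does P? then K.1# else K.0#)
  indicates-does (yes p) = (λ _ → K.refl) , contradiction p
  indicates-does (no ¬p) = (λ p → contradiction p ¬p) , λ _ → K.refl

  monomialSum-lookup : ∀ w {P : Pred (Coloring (length w)) 0ℓ} (P? : Decidable P) →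
                       Indicates (P (lookup w)) (monomialSum K P? w)
  -- The length test compares `length w` with itself; the rewrite selects its `yes refl` branch.
  monomialSum-lookup w P? rewrite ℕ.≟-diag {length w} refl = indicates-does (P? (lookup w))

  monomialSum-length : ∀ {n} w {P : Pred (Coloring n) 0ℓ} (P? : Decidable P) → length w ≢ n →
                       monomialSum K P? w K.≈ K.0#
  monomialSum-length {n} w P? ≢n with length w ℕ.≟ n
  ... | yes ≡n = contradiction ≡n ≢n
  ... | no _   = K.refl

  Υ-kernel : Pred Expr _
  Υ-kernel = Kernel (𝐆 K) (series K) (Υ K)

  -- Each step subtracts the coefficient for `insert G e`. It is 0 when `w` is constant on `e`, and
  -- cancels the other term when it is not.
  Υ-alternating-lookup : ∀ w O (G : Graph (length w)) →
    Indicates (Proper G (lookup w) × All (Monochromatic (lookup w)) O) (Υ K (alternating O G) w)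
  Υ-alternating-lookup w []      G =
    indicates-⇔ (mk⇔ (_, []) proj₁) (monomialSum-lookup w (proper? G))
  Υ-alternating-lookup w (e ∷ O) G with Υ-alternating-lookup w O G
                                      | Υ-alternating-lookup w O (insert G e)
                                      | monochromatic? (lookup w) e
  ... | ind | (_ , is0) | yes mono = indicates-⇔
    (mk⇔ (λ (P , monos) → P , mono ∷ monos) (λ { (P , _ ∷ monos) → P , monos }))
    (K.trans difference ∘ proj₁ ind , K.trans difference ∘ proj₂ ind)
    where
    difference : Υ K (alternating O G) w K.+ K.- Υ K (alternating O (insert G e)) w
                 K.≈ Υ K (alternating O G) w
    difference = K.trans
      (K.+-congˡ (K.trans (K.-‿cong (is0 λ (P , _) → proj₂ (to (insert-proper G e) P) mono)) -0#≈0#))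
      (K.+-identityʳ _)
  ... | ind | ind′ | no ¬mono =
      (λ { (_ , mono ∷ _) → contradiction mono ¬mono })
    , λ _ → K.trans (K.+-congʳ same) (K.-‿inverseʳ _)
    where
    same : Υ K (alternating O G) w K.≈ Υ K (alternating O (insert G e)) w
    same = indicates-unique (proper? G (lookup w) ×-dec All.all? (monochromatic? (lookup w)) O) ind
      (indicates-⇔ (mk⇔ (λ (P , monos) → proj₁ (to (insert-proper G e) P) , monos)
                        (λ (P , monos) → from (insert-proper G e) (P , ¬mono) , monos)) ind′)

  Υ-alternating-length : ∀ {n} w O (G : Graph n) → length w ≢ n → Υ K (alternating O G) w K.≈ K.0#
  Υ-alternating-length w []      G ≢n = monomialSum-length w (proper? G) ≢n
  Υ-alternating-length w (e ∷ O) G ≢n = K.trans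
    (K.+-cong (Υ-alternating-length w O G ≢n)
              (K.trans (K.-‿cong (Υ-alternating-length w O (insert G e) ≢n)) -0#≈0#))
    (K.+-identityʳ _)

  Υ-alternating-unsatisfiable : ∀ {n} O (G : Graph n) →
    (∀ f → ¬ (Proper G f × All (Monochromatic f) O)) → Υ-kernel (alternating O G)
  Υ-alternating-unsatisfiable {n} O G unsat w = byLength (length w ℕ.≟ n)
    where
    byLength : Dec (length w ≡ n) → Υ K (alternating O G) w K.≈ K.0#
    byLength (yes refl) = proj₂ (Υ-alternating-lookup w O G) (unsat (lookup w))
    byLength (no ≢n)    = Υ-alternating-length w O G ≢n

  Υ-alternating : ∀ {n} {π : SetPartition n} {H O} → Realizes π H O →
                  ∀ w → Υ K (alternating O H) w K.≈ 𝐦 K (n , π) w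
  Υ-alternating {n} {π} {H} {O} realizes w = byLength (length w ℕ.≟ n)
    where
    byLength : Dec (length w ≡ n) → Υ K (alternating O H) w K.≈ 𝐦 K (n , π) w
    byLength (yes refl) = indicates-unique (hasKernel? π (lookup w))
      (indicates-⇔ (mk⇔ (from (Realizes.hasKernel realizes)) (to (Realizes.hasKernel realizes)))
        (Υ-alternating-lookup w O H))
      (monomialSum-lookup w (hasKernel? π))
    byLength (no ≢n)    = K.trans (Υ-alternating-length w O H ≢n)
                                  (K.sym (monomialSum-length w (hasKernel? π) ≢n))

  Υ-cong : ∀ {x y} → x ≋ y → ∀ w → Υ K x w K.≈ Υ K y w
  Υ-cong = extend-cong (series K) (chromatic K) (λ {s} {t} → chromatic-cong K {s} {t})

  -- The kernel contains the modular relations.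

  Υ-kernel-isSubmodule : IsSubmodule Υ-kernel
  Υ-kernel-isSubmodule = record
    { resp      = λ x≋y Υx≈0 w → K.trans (Υ-cong (≋-sym x≋y) w) (Υx≈0 w)
    ; 0-closed  = λ _ → K.refl
    ; +-closed  = λ Υx≈0 Υy≈0 w → K.trans (K.+-cong (Υx≈0 w) (Υy≈0 w)) (K.+-identityˡ _)
    ; *ₗ-closed = λ a Υx≈0 w → K.trans (K.*-congˡ (Υx≈0 w)) (K.zeroʳ a)
    }

  -- A coloring that is constant on `ij` and on `ik` cannot be proper on the edge `jk`.
  modularRelation∈kernel : ∀ t → Υ-kernel (modularRelation K t)
  modularRelation∈kernel t = IsSubmodule.resp Υ-kernel-isSubmodule
    (≋-sym (modularRelation≋alternating t))
    (Υ-alternating-unsatisfiable ((i , j , i≢j) ∷ (i , k , i≢k) ∷ []) graph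
      λ { f (P , ij ∷ ik ∷ []) → P j k e₃∈ (trans (sym ij) ik) })
    where open ModularTriangle t

  Modular⊆kernel : ∀ {x} → Modular x → Υ-kernel x
  Modular⊆kernel = Span-least (modularRelation K) Υ-kernel-isSubmodule modularRelation∈kernel

  -- Recovery of an element from its series, modulo modular relations.

  Φₙ : ℕ → Series K → Expr
  Φₙ n s = splitSum (allEdges n) λ I O →
    s (tabulate (Leaf.coloring I O)) ⊙ alternating O (insertAll edgeless I)

  -- Only the degrees below `N` enter: a series may be nonzero in infinitely many degrees, so a
  -- bound keeps the sum finite.
  Φ : ℕ → Series K → Expr
  Φ zero    s = 𝟎
  Φ (suc n) s = Φ n s ⊕ Φₙ n s


  Φ-cong : ∀ N {s t} → s 𝐒ᴹ.≈ᴹ t → Φ N s ≋ Φ N t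
  Φ-cong zero    s≈t = ≋-refl
  Φ-cong (suc N) s≈t = ⊕-cong (Φ-cong N s≈t)
    (splitSum-cong (allEdges N) λ _ _ → ⊙-cong (s≈t _) ≋-refl)

  Φ-+ : ∀ N s t → Φ N (s 𝐒ᴹ.+ᴹ t) ≋ Φ N s ⊕ Φ N t
  Φ-+ zero    s t = ≋-sym (⊕-identityˡ 𝟎)
  Φ-+ (suc N) s t = ≋-trans
    (⊕-cong (Φ-+ N s t) (≋-trans (splitSum-cong (allEdges N) λ _ _ → ⊙-distribʳ _ _ _)
                                 (splitSum-+ (allEdges N) _ _)))
    (interchange _ _ _ _)

  Φ-* : ∀ N a s → Φ N (a 𝐒ᴹ.*ₗ s) ≋ a ⊙ Φ N s
  Φ-* zero    a s = ≋-sym (⊙-zeroʳ a)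
  Φ-* (suc N) a s = ≋-trans
    (⊕-cong (Φ-* N a s) (≋-trans (splitSum-cong (allEdges N) λ _ _ → ⊙-assoc _ _ _)
                                 (splitSum-* (allEdges N) a _)))
    (≋-sym (⊙-distribˡ _ _ _))

  Φₙ-0 : ∀ n s → (∀ w → length w ≡ n → s w K.≈ K.0#) → Φₙ n s ≋ 𝟎
  Φₙ-0 n s s≈0 = splitSum-0 (allEdges n) λ I O →
    ≋-trans (⊙-cong (s≈0 _ (length-tabulate _)) ≋-refl) (⊙-zeroˡ _)

  Φ-0 : ∀ N s → (∀ w → length w < N → s w K.≈ K.0#) → Φ N s ≋ 𝟎
  Φ-0 zero    s s≈0 = ≋-refl
  Φ-0 (suc N) s s≈0 = ≋-trans
    (⊕-cong (Φ-0 N s λ w w< → s≈0 w (ℕ.m<n⇒m<1+n w<))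
            (Φₙ-0 N s λ { w refl → s≈0 w (ℕ.n<1+n _) }))
    (⊕-identityˡ 𝟎)

  -- The length of `tabulate f` is `n` only propositionally. Hence `atWord` takes an arbitrary word,
  -- whose length equation can be matched with `refl`.
  chromatic-tabulate : ∀ {n} (G : Graph n) f →
                       Indicates (Proper G f) (chromatic K (n , G) (tabulate f))
  chromatic-tabulate G f = atWord G f (tabulate f) (length-tabulate f) (lookup-tabulate f)
    where
    atWord : ∀ {n} (G : Graph n) f w (eq : length w ≡ n) →
             (∀ i → lookup w (cast (sym eq) i) ≡ f i) →
             Indicates (Proper G f) (chromatic K (n , G) w)
    atWord G f w refl lookup≡f = indicates-⇔
      (mk⇔ (λ P i j ij fi≡fj → P i j ij (trans (lookup≗f i) (trans fi≡fj (sym (lookup≗f j)))))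
           (λ P i j ij wi≡wj → P i j ij (trans (sym (lookup≗f i)) (trans wi≡wj (lookup≗f j)))))
      (monomialSum-lookup w (proper? G))
      where
      lookup≗f : ∀ i → lookup w i ≡ f i
      lookup≗f i = trans (cong (lookup w) (sym (Fin.cast-is-id refl i))) (lookup≡f i)

  -- If an edge of `G` occurs in `O`, the left side vanishes and the coloring, constant on that
  -- edge, is improper. Otherwise all edges of `G` come from `I`, both graphs are `H`, and the
  -- coloring is proper.
  valid-leaf : ∀ {n I O} → Covers (allEdges n) I O → Leaf.Valid I O → ∀ (G : Graph n) →
    alternating O (insertAll G I) ≋
    chromatic K (n , G) (tabulate (Leaf.coloring I O)) ⊙ alternating O (insertAll edgeless I)
  valid-leaf {n} {I} {O} covers valid G = byMeeting (any? (λ (i , j , _) → T? (adj G i j)) O)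
    where
    open Leaf I O

    byMeeting : Dec (Any (λ (i , j , _) → Adjacent G i j) O) →
                alternating O (insertAll G I) ≋
                chromatic K (n , G) (tabulate coloring) ⊙ alternating O H
    byMeeting (yes meets) with (i , j , i≢j) , e∈ , ij ← find meets = ≋-trans
      (alternating-adjacent (i≢j , e∈) (from (insertAll-adjacent G I) (inj₁ ij)))
      (≋-sym (≋-trans (⊙-cong (proj₂ (chromatic-tabulate G coloring) improper) ≋-refl) (⊙-zeroˡ _)))
      where
      improper : ¬ Proper G coloring
      improper P = P i j ij (from (coloring≡ valid) λ ijH → proj₁ valid (lose e∈ ijH))
    byMeeting (no avoids) = ≋-trans (alternating-cong O same)
      (≋-sym (≋-trans (⊙-cong (proj₁ (chromatic-tabulate G coloring) proper) ≋-refl) (⊙-identityˡ _)))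
      where
      G⊆H : G ⊆ᴳ H
      G⊆H {a} {b} ab
        with a≢b , e∈ ← ∈-allEdges {i = a} {b} (λ { refl → subst T (Graph.irreflexive G a) ab })
        with covers e∈
      ... | inj₁ e∈I = ∈⇒insertAll-adjacent edgeless (a≢b , e∈I)
      ... | inj₂ e∈O = contradiction (lose e∈O ab) avoids

      same : insertAll G I ≗ᴳ H
      same = ⊆-antisym (insertAll G I) {H}
        (λ {a} {b} → [ G⊆H {a} {b} , id ] ∘ to (insertAll-adjacent G I))
        (λ {a} {b} → from (insertAll-adjacent G I {a} {b}) ∘ inj₂)

      proper : Proper G coloring
      proper i j ij ci≡cj = to (coloring≡ valid) ci≡cj (G⊆H ij)

  leaf-∼ : ∀ {n I O} → Covers (allEdges n) I O → ∀ (G : Graph n) →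
    alternating O (insertAll G I) ∼
    chromatic K (n , G) (tabulate (Leaf.coloring I O)) ⊙ alternating O (insertAll edgeless I)
  leaf-∼ {n} {I} {O} covers G = byValidity (Leaf.valid? I O)
    where
    byValidity : Dec (Leaf.Valid I O) → _ ∼ _
    byValidity (yes valid) = ∼-reflexive (valid-leaf covers valid G)
    byValidity (no ¬valid) = ∈⇒∼ (invalid-Modular covers ¬valid G)
                                 (Mod.*ₗ-closed _ (invalid-Modular covers ¬valid edgeless))

  -- The series of `G` lives in degree `n`, so only the summand `Φₙ n` survives, and it agrees with
  -- the expansion of `G` leaf by leaf.
  gen∼Φ : ∀ {n} (G : Graph n) N → n < N → gen (n , G) ∼ Φ N (chromatic K (n , G))
  gen∼Φ {n} G (suc N) n<1+N with n ℕ.≟ N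
  ... | yes refl = ∼-resp (≋-trans (⊕-identityˡ _) (≋-sym (gen-expansion (allEdges n) G))) ≋-refl
    (∼-+ (∼-reflexive (≋-sym (Φ-0 n (chromatic K (n , G))
            λ w w< → monomialSum-length w (proper? G) (ℕ.<⇒≢ w<))))
         (splitSum-rel {_≈_ = _∼_} ∼-+ (allEdges n) λ _ _ covers → leaf-∼ covers G))
  ... | no n≢N   = ∼-resp (𝐆ᴹ.+ᴹ-identityʳ _) ≋-refl
    (∼-+ (gen∼Φ G N (ℕ.≤∧≢⇒< (ℕ.≤-pred n<1+N) n≢N))
         (∼-reflexive (≋-sym (Φₙ-0 N (chromatic K (n , G))
            λ { w refl → monomialSum-length w (proper? G) (n≢N ∘ sym) }))))

  -- An expression mentions finitely many graphs, and `N₀` exceeds all their orders. Allowing every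
  -- larger `N` lets the two terms of a sum share a bound.
  ∼Φ : ∀ x → ∃ λ N₀ → ∀ N → N₀ ≤ N → x ∼ Φ N (Υ K x)
  ∼Φ (gen (n , G)) = suc n , gen∼Φ G
  ∼Φ 𝟎             = 0 , λ N _ → ∼-reflexive (≋-sym (Φ-0 N (λ _ → K.0#) λ _ _ → K.refl))
  ∼Φ (x ⊕ y) with M , x∼ ← ∼Φ x | N , y∼ ← ∼Φ y = max M N , λ n max≤n →
    ∼-resp ≋-refl (≋-sym (Φ-+ n (Υ K x) (Υ K y)))
      (∼-+ (x∼ n (ℕ.m⊔n≤o⇒m≤o M N max≤n)) (y∼ n (ℕ.m⊔n≤o⇒n≤o M N max≤n)))
  ∼Φ (⊖ x) with N₀ , x∼ ← ∼Φ x = N₀ , λ N N₀≤N →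
    ∼-resp (≋-sym (-ᴹ≈-1*ₗ x))
      (≋-sym (≋-trans (Φ-cong N (𝐒.-ᴹ≈-1*ₗ (Υ K x))) (Φ-* N _ (Υ K x))))
      (∼-* _ (x∼ N N₀≤N))
  ∼Φ (a ⊙ x) with N₀ , x∼ ← ∼Φ x = N₀ , λ N N₀≤N →
    ∼-resp ≋-refl (≋-sym (Φ-* N a (Υ K x))) (∼-* a (x∼ N N₀≤N))

  -- The kernel and the image.

  kernel⊆Modular : ∀ {x} → Υ-kernel x → Modular x
  kernel⊆Modular {x} Υx≈0 with N , x∼ ← ∼Φ x =
    -- `Φ N` sends a zero series to zero, so `x` is congruent to zero.
    ∼0⇒∈ (∼-resp ≋-refl (Φ-0 N (Υ K x) λ w _ → Υx≈0 w) (x∼ N ℕ.≤-refl))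

  private module WSymᴹ = 𝐒.IsSubmodule (𝐒.Span-isSubmodule (𝐦 K))

  leaf∈WSym : ∀ {n I O} → Covers (allEdges n) I O →
              WSym K (Υ K (alternating O (insertAll edgeless I)))
  leaf∈WSym {n} {I} {O} covers with Leaf.valid? I O
  ... | yes valid = WSymᴹ.resp
    (λ w → K.sym (Υ-alternating (Leaf.partition-realizes I O valid cover) w))
    (𝐒.Span-generator (𝐦 K) (n , Leaf.partition I O valid))
    where
    cover : ∀ {i j} → i ≢ j → i , j ∈ᴱ I ⊎ i , j ∈ᴱ O
    cover i≢j with p , e∈ ← ∈-allEdges i≢j = Sum.map (p ,_) (p ,_) (covers e∈)
  ... | no ¬valid = WSymᴹ.resp
    (λ w → K.sym (Modular⊆kernel (invalid-Modular covers ¬valid edgeless) w)) WSymᴹ.0-closed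

  ΥΦ∈WSym : ∀ N s → WSym K (Υ K (Φ N s))
  ΥΦ∈WSym zero    s = WSymᴹ.0-closed
  ΥΦ∈WSym (suc N) s = WSymᴹ.+-closed (ΥΦ∈WSym N s)
    -- Membership is treated as a relation that ignores its second argument; `F′` is a dummy.
    (splitSum-rel {_≈_ = λ x _ → WSym K (Υ K x)} WSymᴹ.+-closed (allEdges N) {F′ = λ _ _ → 𝟎}
      λ I O covers → WSymᴹ.*ₗ-closed (s (tabulate (Leaf.coloring I O))) (leaf∈WSym covers))

  -- Replacing `x` by `Φ N (Υ K x)` changes it by a modular element, which `Υ` kills.
  Image⊆WSym : ∀ {s} → Image (𝐆 K) (series K) (Υ K) s → WSym K s
  Image⊆WSym {s} (x , Υx≈s) with N , x∼ ← ∼Φ x with z , z∈ , x≋ ← x∼ N ℕ.≤-refl =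
    WSymᴹ.resp (λ w → K.trans (K.sym (Υx≈ΥΦΥx w)) (Υx≈s w)) (ΥΦ∈WSym N (Υ K x))
    where
    Υx≈ΥΦΥx : ∀ w → Υ K x w K.≈ Υ K (Φ N (Υ K x)) w
    Υx≈ΥΦΥx w = K.trans (Υ-cong x≋ w)
      (K.trans (K.+-congˡ (Modular⊆kernel z∈ w)) (K.+-identityʳ _))

  Image-isSubmodule : 𝐒.IsSubmodule (Image (𝐆 K) (series K) (Υ K))
  Image-isSubmodule = record
    { resp      = λ s≈t (x , Υx≈s) → x , λ w → K.trans (Υx≈s w) (s≈t w)
    ; 0-closed  = 𝟎 , λ _ → K.refl
    ; +-closed  = λ (x , Υx≈s) (y , Υy≈t) → x ⊕ y , λ w → K.+-cong (Υx≈s w) (Υy≈t w)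
    ; *ₗ-closed = λ a (x , Υx≈s) → a ⊙ x , λ w → K.*-congˡ (Υx≈s w)
    }

  WSym⊆Image : ∀ {s} → WSym K s → Image (𝐆 K) (series K) (Υ K) s
  WSym⊆Image = 𝐒.Span-least (𝐦 K) Image-isSubmodule λ (n , π) →
    alternating (filter (withinBlock? π) (allEdges n)) (multipartite π) ,
    Υ-alternating (multipartite-realizes π)

theorem1 : {c ℓ₁ ℓ₂ : Level} (K : HeytingField c ℓ₁ ℓ₂) → CharacteristicZero K →
    let open LinearAlgebra (scalars K) in
    (Kernel (𝐆 K) (series K) (Υ K) ≐ Span (𝐆 K) (modularRelation K))
    × (Image (𝐆 K) (series K) (Υ K) ≐ WSym K)
theorem1 K _ = (kernel⊆Modular , Modular⊆kernel) , (Image⊆WSym , WSym⊆Image)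
  where open Chromatic K
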